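{- Let $X$ be a metrizable Priestley space. Then $X$ is not the dual of a co-Heyting algebra if and only if there are $i\in\{1,2,3\}$, a topological and order embedding $e\colon Z_i^*\to X$, and an open neighborhood $U$ of $e(y)$ such that $e^{ -1}({\uparrow}U)=\{x,y\}$.
   Context: For a poset $X$ and $A\subseteq X$, ${\uparrow}A=\{x\in X\mid a\le x\text{ for some }a\in A\}$; $A$ is an upset if ${\uparrow}A=A$. A Priestley space is a compact topological space $X$ with a partial order such that whenever $x\nleq y$ there is a clopen upset $U$ with $x\in U$, $y\notin U$. By Priestley duality, each Priestley space $X$ is the dual of the bounded distributive lattice of its clopen upsets. A co-Heyting algebra is the order-dual of a Heyting algebra; $X$ is the dual of a co-Heyting algebra when its lattice of clopen upsets is a co-Heyting algebra, equivalently, when the upset ${\uparrow}V$ of each open set $V\subseteq X$ is open. The Priestley spaces $Z_1^*,Z_2^*,Z_3^*$ are obtained by reversing the order in the Priestley spaces $Z_1,Z_2,Z_3$, respectively. The latter all have as underlying topological space the one-point compactification of the countable discrete space $\{y\}\cup\{z_n\mid n\in\omega\}$ (all points distinct), where $x$ is the added point. Their orders have exactly the following strict relations. - $Z_1$: $x<y$; $z_0>z_1>z_2>\cdots$; $x<z_n$ for all $n$. - $Z_2$: $x<y$ and $x<z_n$ for all $n$. - $Z_3$: $x<y$ only. -}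

-- Classical point-set topology over types in Set.  Subsets are predicates,
-- compared up to extensional equality _≐_.  The underlying mathematics is
-- classical, so excluded middle is passed explicitly wherever it is needed.
-- Because it decides arbitrary types and existence is expressed by Σ-types,
-- it also supplies the choice principles of ordinary mathematics.

module Defs where

open import Axiom.ExcludedMiddle using (ExcludedMiddle)
open import Data.Empty using (⊥; ⊥-elim)
open import Data.Fin.Base using (Fin; zero; suc)
open import Data.List.Base using (List; []; _∷_; _++_)
open import Data.List.Relation.Unary.Any using (Any; here; there)
open import Data.List.Relation.Unary.Any.Properties using (++⁺ˡ; ++⁺ʳ)
open import Data.Maybe.Base using (Maybe; just; nothing)
open import Data.Nat.Base as ℕ using (ℕ)
import Data.Nat.Properties as ℕ
open import Data.Product.Base using (∃; _×_; _,_; proj₁; proj₂; swap)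
open import Data.Rational.Base as ℚ using (ℚ; 0ℚ; 1ℚ)
import Data.Rational.Properties as ℚ
open import Data.Sum.Base using (_⊎_; inj₁; inj₂; [_,_])
open import Data.Unit.Base using (⊤; tt)
open import Function.Base using (_∘_; id; flip)
open import Function.Bundles using (_⇔_)
open import Level using (0ℓ; Lift) renaming (suc to lsuc)
open import Relation.Binary.Core using (Rel)
open import Relation.Binary.Construct.Flip.EqAndOrd
  using () renaming (isPartialOrder to flip-isPartialOrder)
import Relation.Binary.Construct.StrictToNonStrict as StrictToNonStrict
open import Relation.Binary.Definitions
  using (Irreflexive; Transitive; tri<; tri≈; tri>)
open import Relation.Binary.Lattice.Bundles using (BoundedLattice)
open import Relation.Binary.Lattice.Structures using (IsHeytingAlgebra)
open import Relation.Binary.Morphism.Structures using (IsOrderMonomorphism)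
open import Relation.Binary.PropositionalEquality
  using (_≡_; refl; sym; trans; cong; subst; resp₂; isEquivalence)
open import Relation.Binary.Structures
  using (IsPartialOrder; IsStrictPartialOrder)
open import Relation.Nullary using (¬_; yes; no)
open import Relation.Unary
  using (Pred; _∈_; _∉_; _⊆_; _≐_; _∩_; _∪_; ⋃; ∁; ∅; U; _⊢_)

------------------------------------------------------------------------
-- Real numbers

-- Dedekind's (classical) reals: the left halves of cuts of ℚ.
record ℝ : Set₁ where
  field
    below     : Pred ℚ 0ℓ
    inhabited : ∃ λ q → q ∈ below
    bounded   : ∃ λ q → q ∉ below
    downward  : ∀ {p q} → p ℚ.< q → q ∈ below → p ∈ below
    no-max    : ∀ {q} → q ∈ below → ∃ λ r → q ℚ.< r × r ∈ below

open ℝ public using (below)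

infix 4 _≈ℝ_ _≤ℝ_ _<ℝ_

_≈ℝ_ _≤ℝ_ : Rel ℝ 0ℓ
a ≈ℝ b = below a ≐ below b
a ≤ℝ b = below a ⊆ below b

_<ℝ_ : Rel ℝ 0ℓ
a <ℝ b = ∃ λ q → q ∉ below a × q ∈ below b

0ℝ : ℝ
0ℝ = record
  { below     = ℚ._< 0ℚ
  ; inhabited = ℚ.- 1ℚ , ℚ.negative⁻¹ (ℚ.- 1ℚ)
  ; bounded   = 0ℚ , ℚ.<-irrefl refl
  ; downward  = ℚ.<-trans
  ; no-max    = ℚ.<-dense
  }

infixl 6 _+ℝ_

_+ℝ_ : ℝ → ℝ → ℝ
a +ℝ b = record
  { below     = λ r → ∃ λ p → ∃ λ q → p ∈ below a × q ∈ below b × r ≡ p ℚ.+ q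
  ; inhabited = let (p , p∈a) = A.inhabited ; (q , q∈b) = B.inhabited
                in p ℚ.+ q , p , q , p∈a , q∈b , refl
  ; bounded   = let (s , s∉a) = A.bounded ; (t , t∉b) = B.bounded
                in s ℚ.+ t , λ { (p , q , p∈a , q∈b , eq) →
                     ℚ.<-irrefl (sym eq)
                       (ℚ.+-mono-< (∉⇒> a s∉a p∈a) (∉⇒> b t∉b q∈b)) }
  ; downward  = λ { {r} r<p+q (p , q , p∈a , q∈b , refl) →
                  r ℚ.- q , q ,
                  A.downward
                    (subst (r ℚ.- q ℚ.<_) (+-cancel p q)
                      (ℚ.+-monoˡ-< (ℚ.- q) r<p+q)) p∈a ,
                  q∈b , sym (-+cancel r q) }
  ; no-max    = λ { (p , q , p∈a , q∈b , refl) →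
                  let (p′ , p<p′ , p′∈a) = A.no-max p∈a in
                  p′ ℚ.+ q , ℚ.+-monoˡ-< q p<p′ ,
                  p′ , q , p′∈a , q∈b , refl }
  }
  where
  module A = ℝ a
  module B = ℝ b

  ∉⇒> : ∀ (c : ℝ) {s p} → s ∉ below c → p ∈ below c → p ℚ.< s
  ∉⇒> c {s} {p} s∉c p∈c with ℚ.<-cmp p s
  ... | tri< p<s _ _  = p<s
  ... | tri≈ _ refl _ = ⊥-elim (s∉c p∈c)
  ... | tri> _ _ s<p  = ⊥-elim (s∉c (ℝ.downward c s<p p∈c))

  +-cancel : ∀ p q → (p ℚ.+ q) ℚ.- q ≡ p
  +-cancel p q = trans (ℚ.+-assoc p q (ℚ.- q))
    (trans (cong (p ℚ.+_) (ℚ.+-inverseʳ q)) (ℚ.+-identityʳ p))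

  -+cancel : ∀ p q → (p ℚ.- q) ℚ.+ q ≡ p
  -+cancel p q = trans (ℚ.+-assoc p (ℚ.- q) q)
    (trans (cong (p ℚ.+_) (ℚ.+-inverseˡ q)) (ℚ.+-identityʳ p))

------------------------------------------------------------------------
-- Topological spaces

record TopologicalSpace : Set₂ where
  field
    Carrier      : Set
    IsOpen       : Pred (Pred Carrier 0ℓ) (lsuc 0ℓ)
    IsOpen-resp  : ∀ {A B} → A ≐ B → IsOpen A → IsOpen B
    IsOpen-whole : IsOpen U
    IsOpen-∩     : ∀ {A B} → IsOpen A → IsOpen B → IsOpen (A ∩ B)
    IsOpen-⋃     : ∀ {I : Set} {A : I → Pred Carrier 0ℓ} →
                   (∀ i → IsOpen (A i)) → IsOpen (⋃ I A)

  IsClopen : Pred (Pred Carrier 0ℓ) _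
  IsClopen A = IsOpen A × IsOpen (∁ A)

  IsCompact : Pred (Pred Carrier 0ℓ) _
  IsCompact C = ∀ (I : Set) (A : I → Pred Carrier 0ℓ) →
    (∀ i → IsOpen (A i)) → C ⊆ ⋃ I A →
    ∃ λ (is : List I) → C ⊆ (λ p → Any (λ i → p ∈ A i) is)

  IsOpen-∅ : IsOpen ∅
  IsOpen-∅ = IsOpen-resp ((λ { (() , _) }) , λ ()) (IsOpen-⋃ {⊥} {λ ()} λ ())

  IsOpen-∪ : ∀ {A B} → IsOpen A → IsOpen B → IsOpen (A ∪ B)
  IsOpen-∪ {A} {B} oA oB = IsOpen-resp
    ( (λ { (zero , p∈A) → inj₁ p∈A ; (suc zero , p∈B) → inj₂ p∈B })
    , λ { (inj₁ p∈A) → zero , p∈A ; (inj₂ p∈B) → suc zero , p∈B } )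
    (IsOpen-⋃ {Fin 2} {λ { zero → A ; (suc _) → B }}
      λ { zero → oA ; (suc _) → oB })

discrete : Set → TopologicalSpace
discrete S = record
  { Carrier      = S
  ; IsOpen       = λ _ → Lift _ ⊤
  ; IsOpen-resp  = λ _ → id
  ; IsOpen-whole = _
  ; IsOpen-∩     = _
  ; IsOpen-⋃     = _
  }

-- The added point is `nothing`.
onePointCompactification : ExcludedMiddle 0ℓ → TopologicalSpace → TopologicalSpace
onePointCompactification em Y = record
  { Carrier      = Maybe Carrier
  ; IsOpen       = λ A → IsOpen (just ⊢ A) × (nothing ∈ A → IsCompact (∁ (just ⊢ A)))
  ; IsOpen-resp  = λ { (A⊆B , B⊆A) (oA , cA) →
      IsOpen-resp ((λ {p} → A⊆B {just p}) , λ {p} → B⊆A {just p}) oA ,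
      λ ∞∈B I V oV cover →
        let (is , fin) = cA (B⊆A ∞∈B) I V oV (λ p∉A → cover (p∉A ∘ B⊆A))
        in is , λ p∉B → fin (p∉B ∘ A⊆B) }
  ; IsOpen-whole = IsOpen-whole , λ _ _ _ _ _ → [] , λ ¬tt → ⊥-elim (¬tt tt)
  ; IsOpen-∩     = λ { {A} {B} (oA , cA) (oB , cB) →
      IsOpen-∩ oA oB ,
      λ { (∞∈A , ∞∈B) I V oV cover →
        let (is , finA) = cA ∞∈A I V oV (λ p∉A → cover (p∉A ∘ proj₁))
            (js , finB) = cB ∞∈B I V oV (λ p∉B → cover (p∉B ∘ proj₂))
        in is ++ js , λ {p} p∉A∩B →
             [ ++⁺ˡ ∘ finA , ++⁺ʳ is ∘ finB ] (split (just ⊢ A) (just ⊢ B) p∉A∩B) } }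
  ; IsOpen-⋃     = λ { {K} {A} o →
      IsOpen-⋃ (proj₁ ∘ o) ,
      λ { (k , ∞∈Ak) I V oV cover →
        let (is , fin) = proj₂ (o k) ∞∈Ak (I ⊎ K) [ V , (λ l → just ⊢ A l) ]
                           [ oV , proj₁ ∘ o ]
                           (λ {p} _ → enlarge V (λ l → just ⊢ A l) cover p)
        in lefts is , λ {p} p∉⋃A →
             any-lefts V (λ l → just ⊢ A l) p∉⋃A is (fin (λ p∈Ak → p∉⋃A (k , p∈Ak))) } }
  }
  where
  open TopologicalSpace Y

  split : ∀ (A B : Pred Carrier 0ℓ) {p} → p ∉ A ∩ B → p ∉ A ⊎ p ∉ B
  split A B {p} p∉A∩B with em {p ∈ A}
  ... | no  p∉A = inj₁ p∉A
  ... | yes p∈A = inj₂ λ p∈B → p∉A∩B (p∈A , p∈B)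

  enlarge : ∀ {I K : Set} (V : I → Pred Carrier 0ℓ) (A : K → Pred Carrier 0ℓ) →
            ∁ (⋃ K A) ⊆ ⋃ I V → ∀ p → p ∈ ⋃ (I ⊎ K) [ V , A ]
  enlarge {K = K} V A cover p with em {p ∈ ⋃ K A}
  ... | yes (k , p∈Ak) = inj₂ k , p∈Ak
  ... | no  p∉⋃A       = let (i , p∈Vi) = cover p∉⋃A in inj₁ i , p∈Vi

  lefts : ∀ {I K : Set} → List (I ⊎ K) → List I
  lefts []            = []
  lefts (inj₁ i ∷ is) = i ∷ lefts is
  lefts (inj₂ _ ∷ is) = lefts is

  any-lefts : ∀ {I K : Set} (V : I → Pred Carrier 0ℓ) (A : K → Pred Carrier 0ℓ) {p} →
              p ∉ ⋃ K A → (is : List (I ⊎ K)) →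
              Any (λ i → p ∈ [ V , A ] i) is → Any (λ i → p ∈ V i) (lefts is)
  any-lefts V A p∉⋃A (inj₁ i ∷ is) (here p∈Vi) = here p∈Vi
  any-lefts V A p∉⋃A (inj₂ k ∷ is) (here p∈Ak) = ⊥-elim (p∉⋃A (k , p∈Ak))
  any-lefts V A p∉⋃A (inj₁ i ∷ is) (there any) = there (any-lefts V A p∉⋃A is any)
  any-lefts V A p∉⋃A (inj₂ k ∷ is) (there any) = any-lefts V A p∉⋃A is any

------------------------------------------------------------------------
-- Metrizability

record IsMetric {S : Set} (d : S → S → ℝ) : Set where
  field
    nonneg    : ∀ p q → 0ℝ ≤ℝ d p q
    d≈0⇔≡     : ∀ p q → d p q ≈ℝ 0ℝ ⇔ p ≡ q
    symmetric : ∀ p q → d p q ≈ℝ d q p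
    triangle  : ∀ p q r → d p r ≤ℝ d p q +ℝ d q r

IsMetricOpen : {S : Set} → (S → S → ℝ) → Pred (Pred S 0ℓ) _
IsMetricOpen d A = ∀ p → p ∈ A →
  ∃ λ (ε : ℝ) → 0ℝ <ℝ ε × (∀ q → d p q <ℝ ε → q ∈ A)

Metrizable : TopologicalSpace → Set₁
Metrizable X = ∃ λ (d : Carrier → Carrier → ℝ) →
  IsMetric d × (∀ A → IsOpen A ⇔ IsMetricOpen d A)
  where open TopologicalSpace X

------------------------------------------------------------------------
-- Ordered topological spaces and Priestley spaces

record OrderedSpace : Set₂ where
  field
    space : TopologicalSpace
  open TopologicalSpace space public
  infix 4 _≤_
  field
    _≤_            : Rel Carrier 0ℓ
    isPartialOrder : IsPartialOrder _≡_ _≤_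

  ↑_ : Pred Carrier 0ℓ → Pred Carrier 0ℓ
  (↑ A) p = ∃ λ a → a ∈ A × a ≤ p

  IsUpset : Pred (Pred Carrier 0ℓ) 0ℓ
  IsUpset A = ↑ A ≐ A

orderDual : OrderedSpace → OrderedSpace
orderDual X = record
  { space          = space
  ; _≤_            = flip _≤_
  ; isPartialOrder = flip-isPartialOrder isPartialOrder
  }
  where open OrderedSpace X

record PriestleySpace : Set₂ where
  field
    orderedSpace : OrderedSpace
  open OrderedSpace orderedSpace public
  field
    compact    : IsCompact U
    separation : ∀ p q → ¬ p ≤ q →
                 ∃ λ A → IsClopen A × IsUpset A × p ∈ A × q ∉ A

record IsEmbedding (X Y : OrderedSpace)
    (e : OrderedSpace.Carrier X → OrderedSpace.Carrier Y) : Set₁ where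
  private
    module X = OrderedSpace X
    module Y = OrderedSpace Y
  field
    orderEmbedding : IsOrderMonomorphism _≡_ _≡_ X._≤_ Y._≤_ e
    continuous     : ∀ {B} → Y.IsOpen B → X.IsOpen (e ⊢ B)
    -- Together with continuity and injectivity: e is a homeomorphism onto
    -- its image with the subspace topology.
    open-in-image  : ∀ {A} → X.IsOpen A → ∃ λ B → Y.IsOpen B × A ≐ (e ⊢ B)

------------------------------------------------------------------------
-- Duality

IsCoHeyting : ∀ {c ℓ₁ ℓ₂} → BoundedLattice c ℓ₁ ℓ₂ → Set _
IsCoHeyting L = ∃ λ _⇨_ →
  IsHeytingAlgebra L._≈_ (flip L._≤_) L._∧_ L._∨_ _⇨_ L.⊥ L.⊤
  where module L = BoundedLattice L

module _ (em : ExcludedMiddle 0ℓ) (X : PriestleySpace) where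
  open PriestleySpace X

  clopenUpsetLattice : BoundedLattice (lsuc 0ℓ) 0ℓ 0ℓ
  clopenUpsetLattice = record
    { Carrier = ∃ λ A → IsClopen A × IsUpset A
    ; _≈_     = λ (A , _) (B , _) → A ≐ B
    ; _≤_     = λ (A , _) (B , _) → A ⊆ B
    ; _∨_     = λ { (A , (oA , oA′) , uA) (B , (oB , oB′) , uB) →
        A ∪ B , (IsOpen-∪ oA oB , IsOpen-resp (∁-∪ A B) (IsOpen-∩ oA′ oB′)) ,
        (λ { (a , inj₁ a∈A , a≤p) → inj₁ (proj₁ uA (a , a∈A , a≤p))
           ; (b , inj₂ b∈B , b≤p) → inj₂ (proj₁ uB (b , b∈B , b≤p)) }) ,
        λ p∈ → _ , p∈ , ≤-refl }
    ; _∧_     = λ { (A , (oA , oA′) , uA) (B , (oB , oB′) , uB) →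
        A ∩ B , (IsOpen-∩ oA oB , IsOpen-resp (∁-∩ A B) (IsOpen-∪ oA′ oB′)) ,
        (λ { (a , (a∈A , a∈B) , a≤p) →
             proj₁ uA (a , a∈A , a≤p) , proj₁ uB (a , a∈B , a≤p) }) ,
        λ p∈ → _ , p∈ , ≤-refl }
    ; ⊤       = U ,
        (IsOpen-whole , IsOpen-resp ((λ ()) , λ ¬tt → ¬tt tt) IsOpen-∅) ,
        (λ _ → tt) , λ p∈ → _ , p∈ , ≤-refl
    ; ⊥       = ∅ ,
        (IsOpen-∅ , IsOpen-resp ((λ _ ()) , λ _ → tt) IsOpen-whole) ,
        (λ { (_ , () , _) }) , λ ()
    ; isBoundedLattice = record
      { isLattice = record
        { isPartialOrder = record
          { isPreorder = record
            { isEquivalence = record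
              { refl  = id , id
              ; sym   = swap
              ; trans = λ (f , g) (h , k) → h ∘ f , g ∘ k
              }
            ; reflexive = proj₁
            ; trans     = λ f g → g ∘ f
            }
          ; antisym = _,_
          }
        ; supremum = λ _ _ → inj₁ , inj₂ , λ _ f g → [ f , g ]
        ; infimum  = λ _ _ → proj₁ , proj₂ , λ _ f g p∈ → f p∈ , g p∈
        }
      ; maximum = λ _ _ → tt
      ; minimum = λ _ ()
      }
    }
    where
    open IsPartialOrder isPartialOrder using () renaming (refl to ≤-refl)

    ∁-∪ : ∀ A B → ∁ A ∩ ∁ B ≐ ∁ (A ∪ B)
    ∁-∪ A B = (λ (p∉A , p∉B) → [ p∉A , p∉B ]) , λ p∉ → p∉ ∘ inj₁ , p∉ ∘ inj₂

    ∁-∩ : ∀ A B → ∁ A ∪ ∁ B ≐ ∁ (A ∩ B)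
    ∁-∩ A B = [ (λ p∉A → p∉A ∘ proj₁) , (λ p∉B → p∉B ∘ proj₂) ] , from
      where
      from : ∁ (A ∩ B) ⊆ ∁ A ∪ ∁ B
      from {p} p∉A∩B with em {p ∈ A}
      ... | no  p∉A = inj₁ p∉A
      ... | yes p∈A = inj₂ λ p∈B → p∉A∩B (p∈A , p∈B)

  IsDualOfCoHeytingAlgebra : Set₁
  IsDualOfCoHeytingAlgebra = IsCoHeyting clopenUpsetLattice

------------------------------------------------------------------------
-- The spaces Z₁, Z₂, Z₃

data Isolated : Set where
  isoY : Isolated
  isoZ : ℕ → Isolated

Point : Set
Point = Maybe Isolated

pattern ptX   = nothing
pattern ptY   = just isoY
pattern ptZ n = just (isoZ n)

data _<₁_ : Rel Point 0ℓ where
  x<y : ptX <₁ ptY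
  x<z : ∀ {n} → ptX <₁ ptZ n
  z<z : ∀ {m n} → n ℕ.< m → ptZ m <₁ ptZ n

data _<₂_ : Rel Point 0ℓ where
  x<y : ptX <₂ ptY
  x<z : ∀ {n} → ptX <₂ ptZ n

data _<₃_ : Rel Point 0ℓ where
  x<y : ptX <₃ ptY

-- Indices 0, 1, 2 stand for 1, 2, 3.
strictOrder : Fin 3 → Rel Point 0ℓ
strictOrder zero             = _<₁_
strictOrder (suc zero)       = _<₂_
strictOrder (suc (suc zero)) = _<₃_

strictOrder-isStrictPartialOrder : ∀ i → IsStrictPartialOrder _≡_ (strictOrder i)
strictOrder-isStrictPartialOrder i = record
  { isEquivalence = isEquivalence
  ; irrefl        = irrefl i
  ; trans         = <-trans i
  ; <-resp-≈      = resp₂ (strictOrder i)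
  }
  where
  irrefl : ∀ i → Irreflexive _≡_ (strictOrder i)
  irrefl zero             refl (z<z n<n) = ℕ.<-irrefl refl n<n
  irrefl (suc zero)       refl ()
  irrefl (suc (suc zero)) refl ()

  <-trans : ∀ i → Transitive (strictOrder i)
  <-trans zero             x<z       (z<z _)   = x<z
  <-trans zero             (z<z n<m) (z<z k<n) = z<z (ℕ.<-trans k<n n<m)
  <-trans (suc zero)       x<y       ()
  <-trans (suc zero)       x<z       ()
  <-trans (suc (suc zero)) x<y       ()

Z Z* : ExcludedMiddle 0ℓ → Fin 3 → OrderedSpace
Z em i = record
  { space          = onePointCompactification em (discrete Isolated)
  ; _≤_            = StrictToNonStrict._≤_ _≡_ (strictOrder i)
  ; isPartialOrder = StrictToNonStrict.isPartialOrder _≡_ (strictOrder i)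
                       (strictOrder-isStrictPartialOrder i)
  }
Z* em i = orderDual (Z em i)

-- Write Z for the common underlying space of the Zᵢ*.  An embedded Zᵢ* whose
-- intersection with ↑ U is {x , y} shows that ↑ U is not open, as {x , y} is
-- not open in Z; but in the dual of a co-Heyting algebra ↑ U is open, being
-- locally of the form ↑ (A ∖ B) with A and B clopen upsets, which is the
-- coimplication of A and B.  Conversely, if some coimplication is missing then
-- ↑ (A ∖ B) is not open, so it contains a non-interior point x, which lies above
-- some y ∈ A ∖ B.  By metrizability a sequence outside ↑ (A ∖ B) tends to x, and
-- Ramsey's theorem thins it out to one of the three order types; the other
-- types are impossible because the order is closed.  As Z is compact and X is
-- Hausdorff, the resulting continuous injection is an embedding.

module Submission where

open import Defs
open import Algebra.Properties.Group using (//-rightDividesˡ)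
open import Axiom.DoubleNegationElimination using (em⇒dne)
open import Axiom.ExcludedMiddle using (ExcludedMiddle)
open import Data.Empty using (⊥-elim)
open import Data.Fin.Base using (Fin; zero; suc)
open import Data.Integer.Base using (+_; -[1+_]; +≤+; +<+)
open import Data.List.Base using (List; []; _∷_; map; upTo)
open import Data.List.Membership.Propositional using () renaming (_∈_ to _∈ˡ_)
open import Data.List.Membership.Propositional.Properties using (∈-map⁺; ∈-upTo⁺)
open import Data.List.Relation.Unary.Any using (Any; here; there)
open import Data.Maybe.Base using (just; nothing)
open import Data.Nat.Base as ℕ using (ℕ; zero; suc; s≤s; z≤n)
import Data.Nat.Coprimality as ℕ
import Data.Nat.Properties as ℕ
open import Data.Product.Base using (∃; _×_; _,_; proj₁; proj₂; map₂)
open import Data.Rational.Base as ℚ using (ℚ; mkℚ; 0ℚ; *≤*; *<*)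
import Data.Rational.Properties as ℚ
open import Data.Sum.Base using (_⊎_; inj₁; inj₂; [_,_])
open import Data.Unit.Base using (tt)
open import Function.Base using (_∘_; id)
open import Function.Bundles using (_⇔_; mk⇔; Equivalence)
open import Function.Definitions using (Injective)
open import Level using (0ℓ) renaming (suc to lsuc)
open import Relation.Binary.Core using (Rel)
open import Relation.Binary.Definitions using (tri<; tri≈; tri>)
open import Relation.Binary.Lattice.Bundles using (BoundedLattice)
open import Relation.Binary.Lattice.Structures using (IsHeytingAlgebra)
import Relation.Binary.Lattice.Properties.Lattice as LatticeProperties
open import Relation.Binary.PropositionalEquality using (_≡_; _≢_; refl; sym; cong; subst)
open import Relation.Binary.Structures using (IsPartialOrder)
open import Relation.Nullary using (¬_; yes; no)
open import Relation.Unary using (Pred; _∈_; _∉_; _⊆_; _≐_; _∩_; _∪_; ∁; ∅; U; _⊢_; ｛_｝)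

-- Neighbourhoods, compactness and sequences in a topological space.

module _ (X : TopologicalSpace) where
  open TopologicalSpace X

  locally-open⇒open : ∀ {A} →
    (∀ {p} → p ∈ A → ∃ λ W → IsOpen W × p ∈ W × W ⊆ A) → IsOpen A
  locally-open⇒open {A} nbhd = IsOpen-resp
    ( (λ ((_ , p∈A) , q∈W) → proj₂ (proj₂ (proj₂ (nbhd p∈A))) q∈W)
    , λ p∈A → (_ , p∈A) , proj₁ (proj₂ (proj₂ (nbhd p∈A))) )
    (IsOpen-⋃ {∃ A} {λ (_ , p∈A) → proj₁ (nbhd p∈A)} λ (_ , p∈A) → proj₁ (proj₂ (nbhd p∈A)))

  -- The sets satisfying `P` form an ideal, so a finite subcover by members of the ideal puts `K` in
  -- it. The level of `P` is free because the witnesses built this way often contain open sets.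
  compact-induction : ∀ {ℓ K} (P : Pred (Pred Carrier 0ℓ) ℓ) → IsCompact K →
    (∀ {S T} → S ⊆ T → P T → P S) → P ∅ → (∀ {S T} → P S → P T → P (S ∪ T)) →
    (∀ {p} → p ∈ K → ∃ λ W → IsOpen W × p ∈ W × P W) → P K
  compact-induction {K = K} P cK antitone P∅ P∪ nbhd =
    let (is , K⊆) = cK (∃ K) W (λ (_ , p∈K) → proj₁ (proj₂ (nbhd p∈K)))
                      (λ p∈K → (_ , p∈K) , proj₁ (proj₂ (proj₂ (nbhd p∈K))))
    in antitone K⊆ (finite is)
    where
    W : ∃ K → Pred Carrier 0ℓ
    W (_ , p∈K) = proj₁ (nbhd p∈K)

    finite : ∀ is → P (λ p → Any (λ i → p ∈ W i) is)
    finite []       = antitone (λ ()) P∅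
    finite (i ∷ is) = antitone
      (λ { (here p∈W) → inj₁ p∈W ; (there p∈Ws) → inj₂ p∈Ws })
      (P∪ (proj₂ (proj₂ (proj₂ (nbhd (proj₂ i))))) (finite is))

  Adherent : Carrier → Pred (Pred Carrier 0ℓ) (lsuc 0ℓ)
  Adherent x T = ∀ W → IsOpen W → x ∈ W → ∃ λ p → p ∈ W × p ∈ T

  adherent-mono : ∀ {x S T} → S ⊆ T → Adherent x S → Adherent x T
  adherent-mono S⊆T adh W oW x∈W = map₂ (map₂ S⊆T) (adh W oW x∈W)

  adherent-∩-open : ∀ {x T W} → IsOpen W → x ∈ W → Adherent x T → Adherent x (T ∩ W)
  adherent-∩-open oW x∈W adh V oV x∈V =
    let (p , (p∈V , p∈W) , p∈T) = adh _ (IsOpen-∩ oV oW) (x∈V , x∈W) in p , p∈V , p∈T , p∈W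

  -- Only eventual inclusion is asked for, so that the neighbourhoods need not decrease.
  HasCountableBasisAt : Carrier → Set₁
  HasCountableBasisAt x = ∃ λ (B : ℕ → Pred Carrier 0ℓ) →
    (∀ n → IsOpen (B n) × x ∈ B n) ×
    (∀ {W} → IsOpen W → x ∈ W → ∃ λ N → ∀ {n} → N ℕ.≤ n → B n ⊆ W)

  -- This is the recursion in the proof of Ramsey's theorem. The state is a set `T` still
  -- accumulating at `x`; after `p` is picked from `T ∩ B n`, the state shrinks to points of
  -- `T ∩ B n` that `p` is `R`-related to. All later picks come from that smaller set.
  adherent-sequence : ∀ {x S} (B : ℕ → Pred Carrier 0ℓ) → (∀ n → IsOpen (B n) × x ∈ B n) →
    (R : Rel Carrier 0ℓ) →
    (∀ {T} → T ⊆ S → Adherent x T → ∃ λ p → p ∈ T × Adherent x (T ∩ R p)) →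
    Adherent x S →
    ∃ λ (z : ℕ → Carrier) → (∀ n → z n ∈ S) × (∀ n → z n ∈ B n) × (∀ {m n} → m ℕ.< n → R (z m) (z n))
  adherent-sequence {x} {S} B oB R step adhS =
    z , (λ n → proj₁ (proj₂ (state n)) (proj₁ (z∈ n))) , proj₂ ∘ z∈ ,
    λ {m} {n} m<n → proj₂ (later {m} {n} m<n (proj₁ (z∈ n)))
    where
    State : Set₁
    State = ∃ λ T → T ⊆ S × Adherent x T

    choose : ∀ n → ((T , _) : State) → ∃ λ p → p ∈ T ∩ B n × Adherent x ((T ∩ B n) ∩ R p)
    choose n (T , T⊆S , adh) =
      step (T⊆S ∘ proj₁) (adherent-∩-open (proj₁ (oB n)) (proj₂ (oB n)) adh)

    state : ℕ → State
    state zero    = S , id , adhS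
    state (suc n) = let (p , _ , adh) = choose n (state n) in
      _ , proj₁ (proj₂ (state n)) ∘ proj₁ ∘ proj₁ , adh

    z : ℕ → Carrier
    z n = proj₁ (choose n (state n))

    z∈ : ∀ n → z n ∈ proj₁ (state n) ∩ B n
    z∈ n = proj₁ (proj₂ (choose n (state n)))

    later : ∀ {m n} → m ℕ.< n → proj₁ (state n) ⊆ proj₁ (state m) ∩ R (z m)
    later {m} {suc n} (s≤s m≤n) ((p∈T , _) , Rzp) with ℕ.m≤n⇒m<n∨m≡n m≤n
    ... | inj₁ m<n  = later m<n p∈T
    ... | inj₂ refl = p∈T , Rzp

-- Countable neighbourhood bases in metrizable spaces.

below⇒< : ∀ (a : ℝ) {p q} → p ∈ below a → q ∉ below a → p ℚ.< q
below⇒< a {p} {q} p∈a q∉a with ℚ.<-cmp p q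
... | tri< p<q _ _  = p<q
... | tri≈ _ refl _ = ⊥-elim (q∉a p∈a)
... | tri> _ _ q<p  = ⊥-elim (q∉a (ℝ.downward a q<p p∈a))

fromℚ : ℚ → ℝ
fromℚ q = record
  { below     = ℚ._< q
  ; inhabited = q ℚ.- ℚ.1ℚ , subst (q ℚ.- ℚ.1ℚ ℚ.<_) (ℚ.+-identityʳ q)
                  (ℚ.+-monoʳ-< q (ℚ.negative⁻¹ (ℚ.- ℚ.1ℚ)))
  ; bounded   = q , ℚ.<-irrefl refl
  ; downward  = ℚ.<-trans
  ; no-max    = ℚ.<-dense
  }

1/suc : ℕ → ℚ
1/suc n = mkℚ (+ 1) n (ℕ.1-coprimeTo (suc n))

archimedean : ∀ {q} → 0ℚ ℚ.< q → ∃ λ N → ∀ {n} → N ℕ.≤ n → 1/suc n ℚ.≤ q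
archimedean {mkℚ (+ zero)  d _} (*<* (+<+ ()))
archimedean {mkℚ -[1+ a ]  d _} (*<* ())
-- The field `d` stores the denominator minus one, so the rational is (a+1)/(d+1), which is at least
-- 1/(d+1).
archimedean {mkℚ (+ suc a) d _} _ = d , λ {n} d≤n →
  *≤* (+≤+ (s≤s (ℕ.+-mono-≤ d≤n (z≤n {a ℕ.* suc n}))))

metrizable⇒countableBasis : ∀ {X} → Metrizable X → ∀ x → HasCountableBasisAt X x
metrizable⇒countableBasis {X} (d , isMetric , open⇔) x =
  ball ∘ 1/suc , (λ n → Equivalence.from (open⇔ _) (ball-open (1/suc n)) , x∈ball n) , basis
  where
  open TopologicalSpace X
  open IsMetric isMetric

  -- The open ball about `x`, with a rational `s` satisfying d(x,q) ≤ s < r as evidence. The slack r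
  -- - s is then a radius that works at `q`.
  ball : ℚ → Pred Carrier 0ℓ
  ball r q = ∃ λ s → s ℚ.< r × s ∉ below (d x q)

  ball-open : ∀ r → IsMetricOpen d (ball r)
  ball-open r q (s , s<r , s∉) =
    fromℚ (r ℚ.- s) ,
    (0ℚ , ℚ.<-irrefl refl , subst (ℚ._< r ℚ.- s) (ℚ.+-inverseʳ s) (ℚ.+-monoˡ-< (ℚ.- s) s<r)) ,
    λ w (t , t∉ , t<r-s) → t ℚ.+ s ,
      subst (t ℚ.+ s ℚ.<_) (//-rightDividesˡ ℚ.+-0-group s r) (ℚ.+-monoˡ-< s t<r-s) ,
      λ t+s∈ → let (u , v , u∈ , v∈ , eq) = triangle x q w t+s∈ in
        ℚ.<-irrefl (sym eq) (subst (u ℚ.+ v ℚ.<_) (ℚ.+-comm s t)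
          (ℚ.+-mono-< (below⇒< (d x q) u∈ s∉) (below⇒< (d q w) v∈ t∉)))

  x∈ball : ∀ n → x ∈ ball (1/suc n)
  x∈ball n = 0ℚ , *<* (+<+ (s≤s z≤n)) ,
    λ 0∈ → ℚ.<-irrefl refl (proj₁ (Equivalence.from (d≈0⇔≡ x x) refl) 0∈)

  basis : ∀ {W} → IsOpen W → x ∈ W → ∃ λ N → ∀ {n} → N ℕ.≤ n → ball (1/suc n) ⊆ W
  basis oW x∈W =
    let (ε , (p , p≮0 , p∈ε) , ball⊆W) = Equivalence.to (open⇔ _) oW x x∈W
        -- `p` may be 0; a larger rational below `ε` gives a positive bound for the radii.
        (q , p<q , q∈ε)                = ℝ.no-max ε p∈ε
        (N , small)                    = archimedean (ℚ.≤-<-trans (ℚ.≮⇒≥ p≮0) p<q)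
    in N , λ N≤n (s , s<r , s∉) →
         ball⊆W _ (s , s∉ , ℝ.downward ε (ℚ.<-≤-trans s<r (small N≤n)) q∈ε)

module _ (em : ∀ {ℓ} → ExcludedMiddle ℓ) where

  -- Classical arguments on compactness and adherence.

  module _ (X : TopologicalSpace) where
    open TopologicalSpace X

    -- Compactness of the whole space is applied to the sets whose trace on `K` satisfies `P`; a
    -- point outside `K` has the neighbourhood `∁ K`, whose trace is empty.
    closed-induction : ∀ {ℓ K} (P : Pred (Pred Carrier 0ℓ) ℓ) → IsCompact U → IsOpen (∁ K) →
      (∀ {S T} → S ⊆ T → P T → P S) → P ∅ → (∀ {S T} → P S → P T → P (S ∪ T)) →
      (∀ {p} → p ∈ K → ∃ λ W → IsOpen W × p ∈ W × P W) → P K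
    closed-induction {K = K} P cU oK antitone P∅ P∪ nbhd = antitone (tt ,_)
      (compact-induction X (λ S → P (S ∩ K)) cU
        (λ S⊆T → antitone λ (p∈S , p∈K) → S⊆T p∈S , p∈K)
        (antitone (λ { (() , _) }) P∅)
        (λ PS PT → antitone (λ { (inj₁ p∈S , p∈K) → inj₁ (p∈S , p∈K)
                               ; (inj₂ p∈T , p∈K) → inj₂ (p∈T , p∈K) }) (P∪ PS PT))
        λ {p} _ → local p)
      where
      local : ∀ p → ∃ λ W → IsOpen W × p ∈ W × P (W ∩ K)
      local p with em {P = p ∈ K}
      ... | yes p∈K = map₂ (map₂ (map₂ (antitone proj₁))) (nbhd p∈K)
      ... | no  p∉K = ∁ K , oK , p∉K , antitone (λ (p∉K , p∈K) → p∉K p∈K) P∅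

    finite⇒compact : ∀ {K} (ps : List Carrier) → K ⊆ (_∈ˡ ps) → IsCompact K
    finite⇒compact {K} ps K⊆ps I V oV K⊆V = map₂ (λ f p∈K → f p∈K (K⊆ps p∈K)) (go ps)
      where
      go : ∀ qs → ∃ λ is → ∀ {p} → p ∈ K → p ∈ˡ qs → Any (λ i → p ∈ V i) is
      go []       = [] , λ _ ()
      go (q ∷ qs) with em {P = q ∈ K} | go qs
      ... | yes q∈K | is , f = proj₁ (K⊆V q∈K) ∷ is ,
        λ { _ (here refl) → here (proj₂ (K⊆V q∈K)) ; p∈K (there p∈qs) → there (f p∈K p∈qs) }
      ... | no  q∉K | is , f = is ,
        λ { p∈K (here refl) → ⊥-elim (q∉K p∈K) ; p∈K (there p∈qs) → f p∈K p∈qs }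

    -- A member of the cover that contains the added point misses only a compact set.
    onePointCompactification-compact :
      TopologicalSpace.IsCompact (onePointCompactification em X) U
    onePointCompactification-compact I A oA cover =
      let (i₀ , ∞∈A) = cover {nothing} tt
          (is , fin) = proj₂ (oA i₀) ∞∈A I (λ i → just ⊢ A i) (proj₁ ∘ oA)
                         (λ {p} _ → cover {just p} tt)
      in i₀ ∷ is , λ { {nothing} _ → here ∞∈A ; {just p} _ → split i₀ is fin p }
      where
      split : ∀ i₀ is → (∀ {p} → p ∉ (just ⊢ A i₀) → Any (λ i → just p ∈ A i) is) →
              ∀ p → Any (λ i → just p ∈ A i) (i₀ ∷ is)
      split i₀ is fin p with em {P = just p ∈ A i₀}
      ... | yes p∈A = here p∈A
      ... | no  p∉A = there (fin p∉A)

    -- Closure commutes with binary unions. This supplies the two-colour dichotomy for the Ramsey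
    -- argument.
    adherent-∖ : ∀ {x S T} → Adherent X x T → ¬ Adherent X x (T ∩ S) → Adherent X x (T ∩ ∁ S)
    adherent-∖ adh ¬adh W oW x∈W = em⇒dne em λ none → ¬adh λ V oV x∈V →
      let (p , (p∈V , p∈W) , p∈T) = adh _ (IsOpen-∩ oV oW) (x∈V , x∈W)
      in p , p∈V , p∈T , em⇒dne em λ p∉S → none (p , p∈W , p∈T , p∉S)

    ¬open⇒adherent : ∀ {A} → ¬ IsOpen A → ∃ λ x → x ∈ A × Adherent X x (∁ A)
    ¬open⇒adherent {A} ¬oA = em⇒dne em λ none → ¬oA (locally-open⇒open X {A} λ {p} p∈A →
      em⇒dne em λ ¬nbhd → none (p , p∈A , λ W oW p∈W →
        em⇒dne em λ W∩∁A-empty → ¬nbhd (W , oW , p∈W , λ {q} q∈W →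
          em⇒dne em λ q∉A → W∩∁A-empty (q , q∈W , q∉A))))

  module _ (Y X : TopologicalSpace) where
    private
      module Y = TopologicalSpace Y
      module X = TopologicalSpace X

    -- The open set is the complement of the image of `∁ A`. To see that it is open, the Hausdorff
    -- property separates a point `b` from the image of each point outside `A`, and compactness
    -- merges the resulting neighbourhoods of `b` into one.
    compact-to-hausdorff : Y.IsCompact U →
      (∀ {p q} → p ≢ q → ∃ λ V → ∃ λ W → X.IsOpen V × X.IsOpen W × p ∈ V × q ∈ W × V ⊆ ∁ W) →
      (e : Y.Carrier → X.Carrier) → Injective _≡_ _≡_ e →
      (∀ {B} → X.IsOpen B → Y.IsOpen (e ⊢ B)) →
      ∀ {A} → Y.IsOpen A → ∃ λ B → X.IsOpen B × A ≐ (e ⊢ B)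
    compact-to-hausdorff cY hausdorff e injective continuous {A} oA =
      (λ b → ∀ p → e p ≡ b → p ∈ A) ,
      locally-open⇒open X (λ {b} b∈ →
        let (W , oW , b∈W , disjoint) = compact-induction Y
              (λ S → ∃ λ W → X.IsOpen W × b ∈ W × (∀ {p} → p ∈ S → e p ∈ W → p ∈ A))
              cY
              (λ S⊆T → map₂ (map₂ (map₂ λ d p∈S → d (S⊆T p∈S))))
              (U , X.IsOpen-whole , tt , λ ())
              (λ (V , oV , b∈V , dV) (W , oW , b∈W , dW) →
                V ∩ W , X.IsOpen-∩ oV oW , (b∈V , b∈W) ,
                λ { (inj₁ p∈S) (p∈V , _) → dV p∈S p∈V ; (inj₂ p∈T) (_ , p∈W) → dW p∈T p∈W })
              (λ {p} _ → local b b∈ p)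
        in W , oW , b∈W , λ { c∈W p refl → disjoint tt c∈W }) ,
      (λ p∈A q eq → subst (_∈ A) (sym (injective eq)) p∈A) ,
      λ ep∈B → ep∈B _ refl
      where
      local : ∀ b → (∀ p → e p ≡ b → p ∈ A) → ∀ p →
              ∃ λ V → Y.IsOpen V × p ∈ V ×
                (∃ λ W → X.IsOpen W × b ∈ W × (∀ {q} → q ∈ V → e q ∈ W → q ∈ A))
      local b b∈ p with em {P = p ∈ A}
      ... | yes p∈A = A , oA , p∈A , U , X.IsOpen-whole , tt , λ q∈A _ → q∈A
      ... | no  p∉A with hausdorff (p∉A ∘ b∈ p)
      ... | V , W , oV , oW , p∈V , b∈W , disjoint =
        e ⊢ V , continuous oV , p∈V , W , oW , b∈W , λ q∈V q∈W → ⊥-elim (disjoint q∈V q∈W)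

  -- Priestley separation and coimplications of clopen upsets.

  module _ (X : PriestleySpace) where
    open PriestleySpace X
    open IsPartialOrder isPartialOrder
      using (antisym) renaming (refl to ≤-refl; trans to ≤-trans)
    private
      module L = BoundedLattice (clopenUpsetLattice em X)

      ⟦_⟧ : L.Carrier → Pred Carrier 0ℓ
      ⟦ A , _ ⟧ = A

    upset-closed : ∀ (A : L.Carrier) {p q} → p ≤ q → p ∈ ⟦ A ⟧ → q ∈ ⟦ A ⟧
    upset-closed (_ , _ , ↑A⊆A , _) p≤q p∈A = ↑A⊆A (_ , p∈A , p≤q)

    clopenUpset-open : ∀ (A : L.Carrier) → IsOpen ⟦ A ⟧
    clopenUpset-open (_ , (oA , _) , _) = oA

    clopenUpset-closed : ∀ (A : L.Carrier) → IsOpen (∁ ⟦ A ⟧)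
    clopenUpset-closed (_ , (_ , oA) , _) = oA

    separate : ∀ {p q} → ¬ p ≤ q → ∃ λ A → p ∈ ⟦ A ⟧ × q ∉ ⟦ A ⟧
    separate p≰q = let (A , cA , uA , p∈A , q∉A) = separation _ _ p≰q in (A , cA , uA) , p∈A , q∉A

    hausdorff : ∀ {p q} → p ≢ q →
      ∃ λ V → ∃ λ W → IsOpen V × IsOpen W × p ∈ V × q ∈ W × V ⊆ ∁ W
    hausdorff {p} {q} p≢q with em {P = p ≤ q}
    ... | no p≰q = let (A , p∈A , q∉A) = separate p≰q in
      ⟦ A ⟧ , ∁ ⟦ A ⟧ , clopenUpset-open A , clopenUpset-closed A , p∈A , q∉A , λ r∈A r∉A → r∉A r∈A
    ... | yes p≤q = let (A , q∈A , p∉A) = separate (p≢q ∘ antisym p≤q) in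
      ∁ ⟦ A ⟧ , ⟦ A ⟧ , clopenUpset-closed A , clopenUpset-open A , p∉A , q∈A , id

    ≰-openˡ : ∀ q → IsOpen (λ p → ¬ p ≤ q)
    ≰-openˡ q = locally-open⇒open space λ p≰q → let (A , p∈A , q∉A) = separate p≰q in
      ⟦ A ⟧ , clopenUpset-open A , p∈A , λ r∈A r≤q → q∉A (upset-closed A r≤q r∈A)

    ≰-openʳ : ∀ p → IsOpen (λ q → ¬ p ≤ q)
    ≰-openʳ p = locally-open⇒open space λ p≰q → let (A , p∈A , q∉A) = separate p≰q in
      ∁ ⟦ A ⟧ , clopenUpset-closed A , q∉A , λ r∉A p≤r → r∉A (upset-closed A p≤r p∈A)

    -- The clopen upsets missing `q` cover `K` and are closed under joins, so by compactness a
    -- single one suffices.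
    ↑-separate : ∀ {K q} → IsOpen (∁ K) → q ∉ ↑ K → ∃ λ A → K ⊆ ⟦ A ⟧ × q ∉ ⟦ A ⟧
    ↑-separate {K} {q} oK q∉↑K = closed-induction space
      (λ S → ∃ λ A → S ⊆ ⟦ A ⟧ × q ∉ ⟦ A ⟧) compact oK
      (λ S⊆T (A , T⊆A , q∉A) → A , T⊆A ∘ S⊆T , q∉A)
      (L.⊥ , id , id)
      (λ (A , S⊆A , q∉A) (B , T⊆B , q∉B) →
        A L.∨ B , [ inj₁ ∘ S⊆A , inj₂ ∘ T⊆B ] , [ q∉A , q∉B ])
      λ {p} p∈K → let (A , p∈A , q∉A) = separate (λ p≤q → q∉↑K (p , p∈K , p≤q)) in
        ⟦ A ⟧ , clopenUpset-open A , p∈A , A , id , q∉A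

    -- Each `a` outside `V` differs from `p`, so it is cut off either by a clopen upset `A`
    -- containing `p` but not `a`, or by some `B` containing `a` but not `p`. Compactness of `∁ V`
    -- leaves finitely many, combined by meeting the `A`s and joining the `B`s.
    ∖-basis : ∀ {V p} → IsOpen V → p ∈ V →
      ∃ λ A → ∃ λ B → p ∈ ⟦ A ⟧ × p ∉ ⟦ B ⟧ × ⟦ A ⟧ ∩ ∁ ⟦ B ⟧ ⊆ V
    ∖-basis {V} {p} oV p∈V =
      let (A , B , p∈A , p∉B , ∁V⊆) = closed-induction space
            (λ S → ∃ λ A → ∃ λ B → p ∈ ⟦ A ⟧ × p ∉ ⟦ B ⟧ × S ∩ ⟦ A ⟧ ⊆ ⟦ B ⟧)
            compact (IsOpen-resp ((λ q∈V q∉V → q∉V q∈V) , em⇒dne em) oV)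
            (λ S⊆T → map₂ (map₂ (map₂ (map₂ λ f (q∈S , q∈A) → f (S⊆T q∈S , q∈A)))))
            (L.⊤ , L.⊥ , tt , id , proj₁)
            (λ (A , B , p∈A , p∉B , f) (A′ , B′ , p∈A′ , p∉B′ , f′) →
              A L.∧ A′ , B L.∨ B′ , (p∈A , p∈A′) , [ p∉B , p∉B′ ] ,
              λ { (inj₁ q∈S , q∈A , _)  → inj₁ (f (q∈S , q∈A))
                ; (inj₂ q∈T , _ , q∈A′) → inj₂ (f′ (q∈T , q∈A′)) })
            local
      in A , B , p∈A , p∉B , λ (q∈A , q∉B) → em⇒dne em λ q∉V → q∉B (∁V⊆ (q∉V , q∈A))
      where
      local : ∀ {a} → a ∉ V → ∃ λ W → IsOpen W × a ∈ W ×
        ∃ λ A → ∃ λ B → p ∈ ⟦ A ⟧ × p ∉ ⟦ B ⟧ × W ∩ ⟦ A ⟧ ⊆ ⟦ B ⟧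
      local {a} a∉V with em {P = p ≤ a}
      ... | no p≰a = let (A , p∈A , a∉A) = separate p≰a in
        ∁ ⟦ A ⟧ , clopenUpset-closed A , a∉A , A , L.⊥ , p∈A , id , λ (q∉A , q∈A) → q∉A q∈A
      ... | yes p≤a =
        let (B , a∈B , p∉B) = separate λ a≤p → a∉V (subst (_∈ V) (antisym p≤a a≤p) p∈V) in
        ⟦ B ⟧ , clopenUpset-open B , a∈B , L.⊤ , B , tt , p∉B , proj₁

    ∖-closed : ∀ A B → IsOpen (∁ (⟦ A ⟧ ∩ ∁ ⟦ B ⟧))
    ∖-closed A B = IsOpen-resp
      ( (λ { (inj₁ p∉A) (p∈A , _) → p∉A p∈A ; (inj₂ p∈B) (_ , p∉B) → p∉B p∈B })
      , λ {p} p∉A∖B → split p p∉A∖B )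
      (IsOpen-∪ (clopenUpset-closed A) (clopenUpset-open B))
      where
      split : ∀ p → p ∉ ⟦ A ⟧ ∩ ∁ ⟦ B ⟧ → p ∈ ∁ ⟦ A ⟧ ∪ ⟦ B ⟧
      split p p∉A∖B with em {P = p ∈ ⟦ A ⟧}
      ... | no  p∉A = inj₁ p∉A
      ... | yes p∈A = inj₂ (em⇒dne em λ p∉B → p∉A∖B (p∈A , p∉B))

    ∖⊆⇒⊆∪ : ∀ (A B : L.Carrier) {S : Pred Carrier 0ℓ} → ⟦ A ⟧ ∩ ∁ ⟦ B ⟧ ⊆ S → ⟦ A ⟧ ⊆ S ∪ ⟦ B ⟧
    ∖⊆⇒⊆∪ A B A∖B⊆S {p} p∈A with em {P = p ∈ ⟦ B ⟧}
    ... | yes p∈B = inj₂ p∈B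
    ... | no  p∉B = inj₁ (A∖B⊆S (p∈A , p∉B))

    -- `↑_` preserves unions, so it is enough to treat basic sets `⟦ A ⟧ ∩ ∁ ⟦ B ⟧`. Their upsets
    -- coincide with the coimplications: a point of the coimplication outside the upset would be
    -- excluded by a clopen upset from `↑-separate`, against minimality.
    coHeyting⇒↑-open : IsDualOfCoHeytingAlgebra em X → ∀ {V} → IsOpen V → IsOpen (↑ V)
    coHeyting⇒↑-open (_⇨_ , isHeyting) oV = locally-open⇒open space λ (p , p∈V , p≤q) →
      let (A , B , p∈A , p∉B , A∖B⊆V) = ∖-basis oV p∈V in
      ↑ (⟦ A ⟧ ∩ ∁ ⟦ B ⟧) , ↑∖-open A B , (p , (p∈A , p∉B) , p≤q) ,
      λ (a , a∈ , a≤r) → a , A∖B⊆V a∈ , a≤r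
      where
      open IsHeytingAlgebra isHeyting using (transpose-⇨; transpose-∧)

      ↑∖-open : ∀ A B → IsOpen (↑ (⟦ A ⟧ ∩ ∁ ⟦ B ⟧))
      ↑∖-open A B = IsOpen-resp
        ( (λ q∈C → em⇒dne em λ q∉↑ →
            let (D , A∖B⊆D , q∉D) = ↑-separate (∖-closed A B) q∉↑
            in q∉D (transpose-⇨ {D} {B} {A} (∖⊆⇒⊆∪ A B A∖B⊆D) q∈C))
        , λ (p , (p∈A , p∉B) , p≤q) → upset-closed C p≤q
            ([ id , ⊥-elim ∘ p∉B ] (transpose-∧ {C} {B} {A} id p∈A)) )
        (clopenUpset-open C)
        where
        C : L.Carrier
        -- Read in the reversed order, this is the least clopen upset `D` with `A` contained in the
        -- union of `D` and `B`.
        C = B ⇨ A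

    -- The upset generated by `A` minus `B` is closed by `↑-separate`, hence clopen under the
    -- hypothesis, and it lies in an upset `D` exactly when `A` lies in the union of `D` and `B`.
    ↑∖-open⇒coHeyting : (∀ A B → IsOpen (↑ (⟦ A ⟧ ∩ ∁ ⟦ B ⟧))) → IsDualOfCoHeytingAlgebra em X
    ↑∖-open⇒coHeyting ↑∖-open = (λ B A → ↑∖ A B) , record
      { isBoundedLattice = record
        { isLattice = LatticeProperties.∧-∨-isLattice L.lattice
        ; maximum   = L.minimum
        ; minimum   = L.maximum
        }
      ; exponential = λ D B A →
          (λ A⊆D∪B (p , (p∈A , p∉B) , p≤q) →
            upset-closed D p≤q ([ id , ⊥-elim ∘ p∉B ] (A⊆D∪B p∈A))) ,
          λ ↑⊆D → ∖⊆⇒⊆∪ A B λ p∈ → ↑⊆D (_ , p∈ , ≤-refl)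
      }
      where
      ↑∖ : L.Carrier → L.Carrier → L.Carrier
      ↑∖ A B = ↑ (⟦ A ⟧ ∩ ∁ ⟦ B ⟧) ,
        (↑∖-open A B , locally-open⇒open space λ q∉↑ →
          let (D , A∖B⊆D , q∉D) = ↑-separate (∖-closed A B) q∉↑ in
          ∁ ⟦ D ⟧ , clopenUpset-closed D , q∉D ,
          λ r∉D (p , p∈ , p≤r) → r∉D (upset-closed D p≤r (A∖B⊆D p∈))) ,
        (λ (q , (p , p∈ , p≤q) , q≤r) → p , p∈ , ≤-trans p≤q q≤r) ,
        λ q∈↑ → _ , q∈↑ , ≤-refl

  -- The common underlying space of the Zᵢ*.

  Z-space : TopologicalSpace
  Z-space = onePointCompactification em (discrete Isolated)

  -- An open set containing the added point has a compact complement in a discrete space. Covering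
  -- it by singletons bounds the indices of its `isoZ` points, yet here the complement contains all
  -- of them.
  xy-not-open : ¬ TopologicalSpace.IsOpen Z-space (｛ ptX ｝ ∪ ｛ ptY ｝)
  xy-not-open (_ , cofinite) =
    let (N , bound) = compact-induction (discrete Isolated)
          (λ S → ∃ λ N → ∀ {n} → isoZ n ∈ S → n ℕ.< N) (cofinite (inj₁ refl))
          (λ S⊆T (N , b) → N , b ∘ S⊆T)
          (0 , λ ())
          (λ (M , b) (N , c) → M ℕ.⊔ N ,
            [ (λ n∈S → ℕ.<-≤-trans (b n∈S) (ℕ.m≤m⊔n M N))
            , (λ n∈T → ℕ.<-≤-trans (c n∈T) (ℕ.m≤n⊔m M N)) ])
          (λ {p} _ → ｛ p ｝ , _ , refl , singleton p)
    in ℕ.<-irrefl refl (bound {N} λ { (inj₁ ()) ; (inj₂ ()) })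
    where
    singleton : ∀ p → ∃ λ N → ∀ {n} → p ≡ isoZ n → n ℕ.< N
    singleton isoY     = 0 , λ ()
    singleton (isoZ m) = suc m , λ { refl → ℕ.≤-refl }

  -- Embeddings of the Zᵢ* given by convergent sequences.

  module _ (X : PriestleySpace) where
    open PriestleySpace X
    open IsPartialOrder isPartialOrder
      using (antisym) renaming (refl to ≤-refl; trans to ≤-trans; reflexive to ≤-reflexive)

    extend : Carrier → Carrier → (ℕ → Carrier) → Point → Carrier
    extend x y z ptX     = x
    extend x y z ptY     = y
    extend x y z (ptZ n) = z n

    -- The preimage of a neighbourhood of `x` misses at most `ptY` and finitely many terms of the
    -- sequence.
    extend-continuous : ∀ {x y z} →
      (∀ {W} → IsOpen W → x ∈ W → ∃ λ N → ∀ {n} → N ℕ.≤ n → z n ∈ W) →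
      ∀ {B} → IsOpen B → TopologicalSpace.IsOpen Z-space (extend x y z ⊢ B)
    extend-continuous converges oB = _ , λ x∈B →
      let (N , tail) = converges oB x∈B in
      finite⇒compact (discrete Isolated) (isoY ∷ map isoZ (upTo N))
        λ { {isoY} _ → here refl
          ; {isoZ n} n∉B → there (∈-map⁺ isoZ (∈-upTo⁺ (ℕ.≰⇒> (n∉B ∘ tail)))) }

    -- The four negated inequalities are the relations absent from all three reversed orders; what
    -- depends on `i` is left to the remaining order hypotheses. In these, the arguments of
    -- `strictOrder` are swapped because Zᵢ* reverses the order.
    extend-embedding : ∀ i {x y z} → ¬ x ≤ y → (∀ n → ¬ x ≤ z n) →
      (∀ n → ¬ y ≤ z n) → (∀ n → ¬ z n ≤ y) →
      (∀ {W} → IsOpen W → x ∈ W → ∃ λ N → ∀ {n} → N ℕ.≤ n → z n ∈ W) →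
      (∀ {p q} → strictOrder i q p → extend x y z p ≤ extend x y z q) →
      strictOrder i ptX ptY →
      (∀ n → z n ≤ x → strictOrder i ptX (ptZ n)) →
      (∀ m n → z m ≤ z n → strictOrder i (ptZ n) (ptZ m) ⊎ m ≡ n) →
      IsEmbedding (Z* em i) orderedSpace (extend x y z)
    extend-embedding i {x} {y} {z} x≰y x≰z y≰z z≰y converges mono xy z≤x⇒ z≤z⇒ = record
      { orderEmbedding = record
        { isOrderHomomorphism = record
          { cong = cong e
          ; mono = [ mono , (λ { refl → ≤-refl }) ]
          }
        ; injective = injective
        ; cancel    = cancel _ _
        }
      ; continuous     = extend-continuous converges
      ; open-in-image  = compact-to-hausdorff Z-space space
          (onePointCompactification-compact (discrete Isolated))
          (hausdorff X) e injective (extend-continuous converges)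
      }
      where
      e : Point → Carrier
      e = extend x y z

      cancel : ∀ p q → e p ≤ e q → strictOrder i q p ⊎ q ≡ p
      cancel ptX     ptX     _   = inj₂ refl
      cancel ptX     ptY     x≤y = ⊥-elim (x≰y x≤y)
      cancel ptX     (ptZ n) x≤z = ⊥-elim (x≰z n x≤z)
      cancel ptY     ptX     _   = inj₁ xy
      cancel ptY     ptY     _   = inj₂ refl
      cancel ptY     (ptZ n) y≤z = ⊥-elim (y≰z n y≤z)
      cancel (ptZ m) ptX     z≤x = inj₁ (z≤x⇒ m z≤x)
      cancel (ptZ m) ptY     z≤y = ⊥-elim (z≰y m z≤y)
      cancel (ptZ m) (ptZ n) z≤z = [ inj₁ , (λ { refl → inj₂ refl }) ] (z≤z⇒ m n z≤z)

      injective : Injective _≡_ _≡_ e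
      -- Equal images are comparable both ways, and `cancel` reflects both inequalities.
      injective eq = IsPartialOrder.antisym (OrderedSpace.isPartialOrder (Z* em i))
        (cancel _ _ (≤-reflexive eq)) (cancel _ _ (≤-reflexive (sym eq)))

    -- Extraction of a sequence of one of the three order types.

    module _ {x y V} (oV : IsOpen V) (y∈V : y ∈ V) (y≤x : y ≤ x)
             (countable : HasCountableBasisAt space x) (adh : Adherent space x (∁ (↑ V))) where

      private
        B : ℕ → Pred Carrier 0ℓ
        B = proj₁ countable

        -- The points available for the sequence, all incomparable with `y`: lying outside `↑ V`
        -- prevents them from being above `y`, and the second condition from being below it.
        S : Pred Carrier 0ℓ
        S = ∁ (↑ V) ∩ λ p → ¬ p ≤ y

        -- Otherwise `x` equals `y`, and `V` is a neighbourhood of `x` contained in `↑ V`, contrary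
        -- to adherence.
        x≰y : ¬ x ≤ y
        x≰y x≤y =
          let (p , p∈V , p∉↑V) = adh V oV (subst (_∈ V) (antisym y≤x x≤y) y∈V)
          in p∉↑V (p , p∈V , ≤-refl)

        x≰ : ∀ {p} → p ∉ ↑ V → ¬ x ≤ p
        x≰ p∉↑V x≤p = p∉↑V (y , y∈V , ≤-trans y≤x x≤p)

        adhS : Adherent space x S
        adhS = adherent-∩-open space (≰-openˡ X y) x≰y adh

        WitnessFor : Fin 3 → Set₁
        WitnessFor i = ∃ λ (e : Point → Carrier) → IsEmbedding (Z* em i) orderedSpace e ×
          (∃ λ U → IsOpen U × e ptY ∈ U × (e ⊢ (↑ U)) ≐ (｛ ptX ｝ ∪ ｛ ptY ｝))

      -- Since x ≰ p for p ∈ T, the points not below p form a neighbourhood of x,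
      -- so the terms of the sequence can be chosen not below any earlier one.
      thinned-embedding : ∀ i {T} (R : Rel Carrier 0ℓ) → T ⊆ S → Adherent space x T →
        (∀ {T′} → T′ ⊆ T → Adherent space x T′ → ∃ λ p → p ∈ T′ × Adherent space x (T′ ∩ R p)) →
        (∀ {z} → (∀ n → z n ∈ T) → (∀ {m n} → m ℕ.< n → R (z m) (z n)) →
          ∀ {p q} → strictOrder i q p → extend x y z p ≤ extend x y z q) →
        strictOrder i ptX ptY →
        (∀ {p} n → p ∈ T → p ≤ x → strictOrder i ptX (ptZ n)) →
        (∀ {p q m n} → m ℕ.< n → R p q → p ≤ q → strictOrder i (ptZ n) (ptZ m)) →
        WitnessFor i
      thinned-embedding i {T} R T⊆S adhT step mono xy p≤x⇒ p≤q⇒ =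
        let (z , z∈T , z∈B , R′z) = adherent-sequence space B (proj₁ (proj₂ countable)) R′ step′ adhT
            z∉↑V n = proj₁ (T⊆S (z∈T n))
        in extend x y z ,
           extend-embedding i x≰y (x≰ ∘ z∉↑V)
             (λ n y≤z → z∉↑V n (y , y∈V , y≤z))
             (λ n → proj₂ (T⊆S (z∈T n)))
             (λ oW x∈W → let (N , tail) = proj₂ (proj₂ countable) oW x∈W in
               N , λ N≤n → tail N≤n (z∈B _))
             (mono {z} z∈T (λ m<n → proj₁ (R′z m<n))) xy (λ n → p≤x⇒ n (z∈T n))
             (z≤z⇒ {z} R′z) ,
           V , oV , y∈V ,
           (λ { {ptX} _ → inj₁ refl ; {ptY} _ → inj₂ refl ; {ptZ n} z∈↑V → ⊥-elim (z∉↑V n z∈↑V) }) ,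
           [ (λ { refl → y , y∈V , y≤x }) , (λ { refl → y , y∈V , ≤-refl }) ]
        where
        R′ : Rel Carrier 0ℓ
        R′ p q = R p q × ¬ q ≤ p

        step′ : ∀ {T′} → T′ ⊆ T → Adherent space x T′ →
                ∃ λ p → p ∈ T′ × Adherent space x (T′ ∩ R′ p)
        step′ T′⊆T adhT′ =
          let (p , p∈T′ , adhR) = step T′⊆T adhT′ in
          p , p∈T′ , adherent-mono space (λ ((q∈T′ , Rpq) , q≰p) → q∈T′ , Rpq , q≰p)
            (adherent-∩-open space (≰-openˡ X p) (x≰ (proj₁ (T⊆S (T′⊆T p∈T′)))) adhR)

        z≤z⇒ : ∀ {z} → (∀ {m n} → m ℕ.< n → R′ (z m) (z n)) →
               ∀ m n → z m ≤ z n → strictOrder i (ptZ n) (ptZ m) ⊎ m ≡ n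
        z≤z⇒ R′z m n zm≤zn with ℕ.<-cmp m n
        ... | tri< m<n _ _ = inj₁ (p≤q⇒ m<n (proj₁ (R′z m<n)) zm≤zn)
        ... | tri≈ _ m≡n _ = inj₂ m≡n
        ... | tri> _ _ n<m = ⊥-elim (proj₂ (R′z n<m) zm≤zn)

      -- Any point of `T′` will do: since the points above it do not accumulate at `x`, discarding
      -- them preserves adherence.
      antichain-step : ∀ {T} →
        (∀ {p} → p ∈ T → ¬ Adherent space x (T ∩ (p ≤_))) →
        ∀ {T′} → T′ ⊆ T → Adherent space x T′ →
        ∃ λ p → p ∈ T′ × Adherent space x (T′ ∩ ∁ (p ≤_))
      antichain-step sparse T′⊆T adhT′ =
        let (p , _ , p∈T′) = adhT′ U IsOpen-whole tt in
        p , p∈T′ , adherent-∖ space adhT′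
          (sparse (T′⊆T p∈T′) ∘ adherent-mono space λ (q∈T′ , p≤q) → T′⊆T q∈T′ , p≤q)

      -- Two dichotomies decide the type. If the points of `S` below `x` do not accumulate at `x`,
      -- they are dropped, and an antichain of points not below `x` gives Z₃*. Otherwise the
      -- sequence is taken below `x`: a sparse adherent set yields an antichain and Z₂*, and its
      -- absence yields an increasing chain and Z₁*.
      embedded-Z* : ∃ WitnessFor
      embedded-Z* with em {P = Adherent space x (S ∩ (_≤ x))}
      ... | no ¬adh = suc (suc zero) , thinned-embedding (suc (suc zero)) (λ p q → ¬ p ≤ q)
        proj₁ (adherent-∖ space adhS ¬adh)
        -- Sparseness is automatic here: the points not above `p` form a neighbourhood of `x`.
        (antichain-step λ (_ , p≰x) adh≥p →
          let (q , p≰q , _ , p≤q) = adh≥p _ (≰-openʳ X _) p≰x in p≰q p≤q)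
        (λ { _ _ x<y → y≤x })
        x<y (λ _ (_ , p≰x) p≤x → ⊥-elim (p≰x p≤x)) (λ _ p≰q p≤q → ⊥-elim (p≰q p≤q))
      ... | yes adh≤x
        with em {P = ∃ λ T → T ⊆ S ∩ (_≤ x) × Adherent space x T ×
                       (∀ {p} → p ∈ T → ¬ Adherent space x (T ∩ (p ≤_)))}
      ... | yes (T , T⊆ , adhT , sparse) = suc zero , thinned-embedding (suc zero) (λ p q → ¬ p ≤ q)
        (proj₁ ∘ T⊆) adhT (antichain-step sparse)
        (λ { z∈T _ x<y → y≤x ; z∈T _ (x<z {n}) → proj₂ (T⊆ (z∈T n)) })
        x<y (λ _ _ _ → x<z) (λ _ p≰q p≤q → ⊥-elim (p≰q p≤q))
      ... | no none = zero , thinned-embedding zero _≤_ proj₁ adh≤x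
        -- An adherent set offering no next term would itself be sparse, which this case excludes.
        (λ T⊆ adhT → em⇒dne em λ no-step →
          none (_ , T⊆ , adhT , λ p∈T adh≥p → no-step (_ , p∈T , adh≥p)))
        (λ { z∈T _ x<y → y≤x ; z∈T _ (x<z {n}) → proj₂ (z∈T n) ; _ Rz (z<z n<m) → Rz n<m })
        x<y (λ _ _ _ → x<z) (λ m<n _ _ → z<z m<n)

corollary3p6 : (em : ∀ {ℓ} → ExcludedMiddle ℓ) (X : PriestleySpace) →
    let open PriestleySpace X in
    Metrizable space →
    (¬ IsDualOfCoHeytingAlgebra em X) ⇔
    (∃ λ (i : Fin 3) →
    ∃ λ (e : Point → Carrier) →
    IsEmbedding (Z* em i) orderedSpace e ×
    (∃ λ U → IsOpen U × e ptY ∈ U × (e ⊢ (↑ U)) ≐ (｛ ptX ｝ ∪ ｛ ptY ｝)))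
corollary3p6 em X metrizable = mk⇔ to from
  where
  open PriestleySpace X

  to : ¬ IsDualOfCoHeytingAlgebra em X → _
  to ¬coHeyting =
    let (A , B , ¬open) = em⇒dne em λ none → ¬coHeyting (↑∖-open⇒coHeyting em X λ A B →
          em⇒dne em λ ¬open → none (A , B , ¬open))
        -- `y` is the point of `A` minus `B` that places `x` in the upset, so this open difference
        -- serves as the neighbourhood of `y`.
        (x , (y , y∈A∖B , y≤x) , adh) = ¬open⇒adherent em space ¬open
    in embedded-Z* em X
         (IsOpen-∩ (clopenUpset-open em X A) (clopenUpset-closed em X B)) y∈A∖B y≤x
         (metrizable⇒countableBasis {space} metrizable x) adh

  from : _ → ¬ IsDualOfCoHeytingAlgebra em X
  from (_ , _ , embedding , U , oU , _ , e⁻¹↑U≐xy) coHeyting =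
    xy-not-open em (TopologicalSpace.IsOpen-resp (Z-space em) e⁻¹↑U≐xy
      (IsEmbedding.continuous embedding (coHeyting⇒↑-open em X coHeyting oU)))
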